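{- Let $m,n\geq 5$ be integers and let $T_{m,n}=C_m\square C_n$ be the torus grid graph. Then the optimal pebbling number satisfies $\pi_{\mathrm{opt}}(T_{m,n})\geq \frac{2}{13}nm$.
   Context: $C_k$ is the cycle on $k$ vertices and $\square$ is the Cartesian product of graphs: $V(G\square H)=V(G)\times V(H)$, with $(g_1,h_1)(g_2,h_2)$ an edge iff ($g_1g_2\in E(G)$ and $h_1=h_2$) or ($h_1h_2\in E(H)$ and $g_1=g_2$). A pebble distribution is a function $P:V\to\mathbb{Z}_{\geq0}$ of size $|P|=\sum_vP(v)$. A pebbling move removes two pebbles from a vertex and adds one pebble to an adjacent vertex. A vertex is reachable under $P$ if some sequence of pebbling moves (keeping all counts nonnegative) places at least one pebble on it; $P$ is solvable if every vertex is reachable. $\pi_{\mathrm{opt}}(G)$ is the minimum size of a solvable distribution on $G$. -}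

module Defs where

open import Data.Nat using (ℕ; zero; suc; _+_; _*_; _∸_; _≤_)
open import Data.Fin using (Fin; toℕ)
open import Data.List using (List; map)
open import Data.Nat.ListAction using (sum)
open import Data.List using () renaming (allFin to allFinL)
open import Data.Product using (_×_; _,_; Σ; ∃)
open import Data.Sum using (_⊎_)
open import Relation.Binary.PropositionalEquality using (_≡_; _≢_)
open import Relation.Binary.Construct.Closure.ReflexiveTransitive using (Star)

record Graph : Set₁ where
  field
    V   : Set
    Adj : V → V → Set

open Graph public

-- The cycle C_k on vertex set Fin k: i ~ j iff j ≡ i + 1 (mod k) or i ≡ j + 1 (mod k).
-- (For k ≥ 3 this is exactly the k-cycle.)
CycleSucc : (k : ℕ) → Fin k → Fin k → Set
CycleSucc k i j = (toℕ j ≡ suc (toℕ i)) ⊎ ((suc (toℕ i) ≡ k) × (toℕ j ≡ 0))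

CycleAdj : (k : ℕ) → Fin k → Fin k → Set
CycleAdj k i j = CycleSucc k i j ⊎ CycleSucc k j i

Cycle : ℕ → Graph
Cycle k = record { V = Fin k ; Adj = CycleAdj k }

_□_ : Graph → Graph → Graph
G □ H = record
  { V   = V G × V H
  ; Adj = λ { (g₁ , h₁) (g₂ , h₂) →
              (Adj G g₁ g₂ × h₁ ≡ h₂) ⊎ (Adj H h₁ h₂ × g₁ ≡ g₂) } }

Torus : ℕ → ℕ → Graph
Torus m n = Cycle m □ Cycle n

Distribution : Graph → Set
Distribution G = V G → ℕ

-- A single pebbling move from P to Q: remove two pebbles from u, add one to an
-- adjacent vertex v; all other vertices unchanged.  (Nonnegativity is built in
-- because Q u + 2 ≡ P u in ℕ.)
record Move (G : Graph) (P Q : Distribution G) : Set where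
  field
    u v    : V G
    adj    : Adj G u v
    at-u   : Q u + 2 ≡ P u
    at-v   : Q v ≡ suc (P v)
    others : ∀ w → w ≢ u → w ≢ v → Q w ≡ P w

Moves : (G : Graph) → Distribution G → Distribution G → Set
Moves G = Star (Move G)

Reachable : (G : Graph) → Distribution G → V G → Set
Reachable G P r = ∃ λ Q → Moves G P Q × 1 ≤ Q r

Solvable : (G : Graph) → Distribution G → Set
Solvable G P = ∀ r → Reachable G P r

size : (m n : ℕ) → Distribution (Torus m n) → ℕ
size m n P = sum (map (λ i → sum (map (λ j → P (i , j)) (allFinL n))) (allFinL m))

{-# OPTIONS --safe #-}
module Submission where

-- Call a vertex rich if two pebbles can be gathered on it; only rich vertices are ever moved
-- from, and every vertex is rich, adjacent to a rich vertex v(x), or pebbled from the start.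
-- With K u v = 2^-dist(u,v), let ψ u v be K u v if rich vertices contain a geodesic from u to v
-- and K u v / 2 otherwise.  Then Σ_{u rich} P(u) ψ u v does not increase under moves, so it is
-- at least 2 at every rich v.  Summing over the v(x) (with v(x) = x for rich x), it suffices that
-- Σ_x ψ u (v(x)) ≤ 13 for each rich u.  Here ψ u (v(x)) ≤ K u x, except for the set T of poor x
-- which extend a rich geodesic from u by one step outwards, where it equals 2 K u x.  On the torus
-- Σ_x K u x ≤ 9, and Σ_{x ∈ T} K u x ≤ 4 by double counting outward edges: 13 = 9 + 4.
-- All weights are scaled by powers of 2 to stay in ℕ.

open import Defs
open import Data.Nat using (ℕ; zero; suc; _+_; _*_; _∸_; _^_; _⊓_; ∣_-_∣; _≤_; _<_; z≤n; s≤s; s≤s⁻¹; _≤?_; >-nonZero; >-nonZero⁻¹)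
  renaming (_≟_ to _≟ℕ_)
open import Data.Nat.Properties hiding (_≟_)
open import Data.Nat.ListAction using () renaming (sum to sumᴸ)
open import Data.Nat.Tactic.RingSolver using (solve-∀)
open import Data.Fin using (Fin; zero; suc; toℕ; fromℕ; inject₁; _≟_)
open import Data.Fin.Properties using (toℕ-injective; toℕ<n; toℕ-fromℕ; toℕ-inject₁; sequence)
open import Data.Fin.Relation.Unary.Top using (view; ‵fromℕ; ‵inject₁)
open import Data.List using () renaming (allFin to allFinᴸ; map to mapᴸ; tabulate to tabulateᴸ)
open import Data.Product using (_×_; _,_; ∃; proj₁; proj₂; uncurry)
open import Data.Product.Properties using (≡-dec)
open import Data.Sum using (_⊎_; inj₁; inj₂; swap; map₂)
open import Algebra.Properties.Semiring.Sum +-*-semiring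
open import Effect.Monad using (RawMonad)
open import Function using (_∘_; id)
open import Relation.Binary.Construct.Closure.ReflexiveTransitive using (ε; _◅_; _◅◅_)
open import Relation.Binary.Definitions using (tri<; tri≈; tri>)
open import Relation.Binary.PropositionalEquality
open import Relation.Nullary using (Dec; yes; no; ¬_; contradiction)
open import Relation.Nullary.Decidable using (¬¬-excluded-middle; decidable-stable)
open import Relation.Nullary.Negation using (¬¬-Monad)

-- Geometry of the cycle

private variable
  k : ℕ
  A : Set

next prev : Fin (suc k) → Fin (suc k)
next i with view i
... | ‵fromℕ     = zero
... | ‵inject₁ j = suc j
prev zero    = fromℕ _
prev (suc i) = inject₁ i

prev-next : (i : Fin (suc k)) → prev (next i) ≡ i
prev-next i with view i
... | ‵fromℕ     = refl
... | ‵inject₁ j = refl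

CycleSucc⇒next : {i j : Fin (suc k)} → CycleSucc (suc k) i j → j ≡ next i
CycleSucc⇒next {k} {i} {j} s with view i
CycleSucc⇒next {k} {_} {j} (inj₁ e) | ‵fromℕ = contradiction (trans e (cong suc (toℕ-fromℕ k))) (<⇒≢ (toℕ<n j))
CycleSucc⇒next (inj₂ (_ , e)) | ‵fromℕ = toℕ-injective e
CycleSucc⇒next (inj₁ e) | ‵inject₁ i′ = toℕ-injective (trans e (cong suc (toℕ-inject₁ i′)))
CycleSucc⇒next (inj₂ (e , _)) | ‵inject₁ i′ =
  contradiction (trans (sym (toℕ-inject₁ i′)) (suc-injective e)) (<⇒≢ (toℕ<n i′))

module CycleDistance (k : ℕ) where

  -- Length of the shorter of the two arcs joining vertices whose indices differ by `e`.
  fold : ℕ → ℕ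
  fold e = e ⊓ (suc k ∸ e)

  dist : Fin (suc k) → Fin (suc k) → ℕ
  dist i j = fold ∣ toℕ i - toℕ j ∣

  dist≤ : ∀ i j → dist i j ≤ suc k
  dist≤ i j = ≤-trans (m⊓n≤n _ (suc k ∸ ∣ toℕ i - toℕ j ∣)) (m∸n≤m (suc k) ∣ toℕ i - toℕ j ∣)

  dist-refl : ∀ i → dist i i ≡ 0
  dist-refl i = cong fold (∣n-n∣≡0 (toℕ i))

  dist-sym : ∀ i j → dist i j ≡ dist j i
  dist-sym i j = cong fold (∣-∣-comm (toℕ i) (toℕ j))

  fold-∸ : ∀ {e} → e ≤ suc k → fold (suc k ∸ e) ≡ fold e
  fold-∸ {e} e≤ = trans (cong ((suc k ∸ e) ⊓_) (m∸[m∸n]≡n e≤)) (⊓-comm (suc k ∸ e) e)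

  fold-suc≤ : ∀ e → fold (suc e) ≤ suc (fold e)
  fold-suc≤ e = ⊓-mono-≤ {suc e} ≤-refl (≤-trans (∸-monoʳ-≤ (suc k) (n≤1+n e)) (n≤1+n _))

  fold≤suc : ∀ e → fold e ≤ suc (fold (suc e))
  fold≤suc e = ⊓-mono-≤ {e} (≤-trans (n≤1+n e) (n≤1+n _)) (m≤n+m∸n′ (suc k) e)
    where
    m≤n+m∸n′ : ∀ a b → a ∸ b ≤ suc (a ∸ suc b)
    m≤n+m∸n′ zero    b       = ≤-trans (≤-reflexive (0∸n≡0 b)) z≤n
    m≤n+m∸n′ (suc a) zero    = ≤-refl
    m≤n+m∸n′ (suc a) (suc b) = m≤n+m∸n′ a b

  -- If `e` is at most its complement, the direct arc is shortest and a smaller gap shortens it;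
  -- otherwise a larger gap shortens the complementary arc.
  fold-inward : ∀ {e e′} → suc e′ ≡ e → e < suc k →
    fold e ≡ suc (fold e′) ⊎ fold e ≡ suc (fold (suc e))
  fold-inward {e′ = e} refl (s≤s e<k) with ≤-total (suc e) (k ∸ e)
  ... | inj₁ le = inj₁ (trans (m≤n⇒m⊓n≡m le)
                    (cong suc (sym (m≤n⇒m⊓n≡m (≤-trans (<⇒≤ le) (∸-monoˡ-≤ e (n≤1+n k)))))))
  ... | inj₂ ge = inj₂ (trans (m≥n⇒m⊓n≡n ge) (trans (+-∸-assoc 1 e<k)
                    (cong suc (sym (m≥n⇒m⊓n≡n (≤-trans (∸-monoʳ-≤ k (n≤1+n e)) (≤-trans ge (n≤1+n _))))))))

  -- Past the last vertex the gap wraps round to the complement of the expected one, so the equation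
  -- is stated after `fold`. In `dist-next->` no wrap can occur, and the gaps themselves are
  -- compared.
  dist-next-≤ : ∀ (i j : Fin (suc k)) → toℕ i ≤ toℕ j → dist i (next j) ≡ fold (suc ∣ toℕ i - toℕ j ∣)
  dist-next-≤ i j i≤j with view j
  ... | ‵fromℕ = begin
      fold ∣ toℕ i - 0 ∣             ≡⟨ cong fold (∣-∣-identityʳ (toℕ i)) ⟩
      fold (toℕ i)                   ≡⟨ fold-∸ (<⇒≤ (toℕ<n i)) ⟨
      fold (suc k ∸ toℕ i)           ≡⟨ cong fold (+-∸-assoc 1 i≤k) ⟩
      fold (suc (k ∸ toℕ i))         ≡⟨ cong (fold ∘ suc) (m≤n⇒∣m-n∣≡n∸m i≤k) ⟨
      fold (suc ∣ toℕ i - k ∣)       ≡⟨ cong (λ x → fold (suc ∣ toℕ i - x ∣)) (toℕ-fromℕ k) ⟨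
      fold (suc ∣ toℕ i - toℕ (fromℕ k) ∣) ∎
    where
    open ≡-Reasoning
    i≤k : toℕ i ≤ k
    i≤k = s≤s⁻¹ (toℕ<n i)
  ... | ‵inject₁ j′ rewrite toℕ-inject₁ j′ = cong fold (begin
      ∣ toℕ i - suc (toℕ j′) ∣  ≡⟨ m≤n⇒∣m-n∣≡n∸m (m≤n⇒m≤1+n i≤j) ⟩
      suc (toℕ j′) ∸ toℕ i      ≡⟨ +-∸-assoc 1 i≤j ⟩
      suc (toℕ j′ ∸ toℕ i)      ≡⟨ cong suc (m≤n⇒∣m-n∣≡n∸m i≤j) ⟨
      suc ∣ toℕ i - toℕ j′ ∣    ∎)
    where open ≡-Reasoning

  dist-next-> : ∀ (i j : Fin (suc k)) → toℕ j < toℕ i → suc ∣ toℕ i - toℕ (next j) ∣ ≡ ∣ toℕ i - toℕ j ∣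
  dist-next-> i j j<i with view j
  ... | ‵fromℕ = contradiction (subst (_< toℕ i) (toℕ-fromℕ k) j<i) (≤⇒≯ (s≤s⁻¹ (toℕ<n i)))
  ... | ‵inject₁ j′ rewrite toℕ-inject₁ j′ = begin
      suc ∣ toℕ i - suc (toℕ j′) ∣  ≡⟨ cong suc (m≤n⇒∣n-m∣≡n∸m j<i) ⟩
      suc (toℕ i ∸ suc (toℕ j′))    ≡⟨ +-∸-assoc 1 j<i ⟨
      toℕ i ∸ toℕ j′                ≡⟨ m≤n⇒∣n-m∣≡n∸m (<⇒≤ j<i) ⟨
      ∣ toℕ i - toℕ j′ ∣            ∎
    where open ≡-Reasoning

  dist-prev-≤ : ∀ (i j : Fin (suc k)) → toℕ j ≤ toℕ i → dist i (prev j) ≡ fold (suc ∣ toℕ i - toℕ j ∣)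
  dist-prev-≤ i zero _ = begin
      fold ∣ toℕ i - toℕ (fromℕ k) ∣ ≡⟨ cong (λ x → fold ∣ toℕ i - x ∣) (toℕ-fromℕ k) ⟩
      fold ∣ toℕ i - k ∣             ≡⟨ cong fold (m≤n⇒∣m-n∣≡n∸m (s≤s⁻¹ (toℕ<n i))) ⟩
      fold (suc k ∸ suc (toℕ i))     ≡⟨ fold-∸ (toℕ<n i) ⟩
      fold (suc (toℕ i))             ≡⟨ cong (fold ∘ suc) (∣-∣-identityʳ (toℕ i)) ⟨
      fold (suc ∣ toℕ i - 0 ∣)       ∎
    where open ≡-Reasoning
  dist-prev-≤ i (suc j′) j<i rewrite toℕ-inject₁ j′ = cong fold (begin
      ∣ toℕ i - toℕ j′ ∣            ≡⟨ m≤n⇒∣n-m∣≡n∸m (<⇒≤ j<i) ⟩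
      toℕ i ∸ toℕ j′                ≡⟨ +-∸-assoc 1 j<i ⟩
      suc (toℕ i ∸ suc (toℕ j′))    ≡⟨ cong suc (m≤n⇒∣n-m∣≡n∸m j<i) ⟨
      suc ∣ toℕ i - suc (toℕ j′) ∣  ∎)
    where open ≡-Reasoning

  dist-prev-> : ∀ (i j : Fin (suc k)) → toℕ i < toℕ j → suc ∣ toℕ i - toℕ (prev j) ∣ ≡ ∣ toℕ i - toℕ j ∣
  dist-prev-> i (suc j′) (s≤s i≤j) rewrite toℕ-inject₁ j′ = begin
      suc ∣ toℕ i - toℕ j′ ∣    ≡⟨ cong suc (m≤n⇒∣m-n∣≡n∸m i≤j) ⟩
      suc (toℕ j′ ∸ toℕ i)      ≡⟨ +-∸-assoc 1 i≤j ⟨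
      suc (toℕ j′) ∸ toℕ i      ≡⟨ m≤n⇒∣m-n∣≡n∸m (m≤n⇒m≤1+n i≤j) ⟨
      ∣ toℕ i - suc (toℕ j′) ∣  ∎
    where open ≡-Reasoning

  dist-next-lipschitz : ∀ i j → dist i (next j) ≤ suc (dist i j) × dist i j ≤ suc (dist i (next j))
  dist-next-lipschitz i j with toℕ i ≤? toℕ j
  ... | yes i≤j rewrite dist-next-≤ i j i≤j = fold-suc≤ _ , fold≤suc _
  ... | no i≰j rewrite sym (dist-next-> i j (≰⇒> i≰j)) = fold≤suc _ , fold-suc≤ _

  gap< : ∀ (i j : Fin (suc k)) → ∣ toℕ i - toℕ j ∣ < suc k
  gap< i j = ≤-<-trans (∣m-n∣≤m⊔n (toℕ i) (toℕ j)) (⊔-lub (toℕ<n i) (toℕ<n j))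

  dist-inward : ∀ i j → j ≢ i →
    dist i j ≡ suc (dist i (next j)) ⊎ dist i j ≡ suc (dist i (prev j))
  dist-inward i j j≢i with <-cmp (toℕ i) (toℕ j)
  ... | tri≈ _ i≡j _ = contradiction (sym (toℕ-injective i≡j)) j≢i
  ... | tri< i<j _ _ = swap (map₂ (λ e → trans e (cong suc (sym (dist-next-≤ i j (<⇒≤ i<j)))))
                                  (fold-inward (dist-prev-> i j i<j) (gap< i j)))
  ... | tri> _ _ j<i = map₂ (λ e → trans e (cong suc (sym (dist-prev-≤ i j (<⇒≤ j<i)))))
                            (fold-inward (dist-next-> i j j<i) (gap< i j))

-- Sums and weights on the cycle

⟦_⟧ : Dec A → ℕ
⟦ yes _ ⟧ = 1
⟦ no _ ⟧  = 0

⟦⟧≤1 : (d : Dec A) → ⟦ d ⟧ ≤ 1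
⟦⟧≤1 (yes _) = ≤-refl
⟦⟧≤1 (no _)  = z≤n

⟦⟧-yes : (d : Dec A) → A → ⟦ d ⟧ ≡ 1
⟦⟧-yes (yes _) _ = refl
⟦⟧-yes (no ¬a) a = contradiction a ¬a

⟦⟧-no : (d : Dec A) → ¬ A → ⟦ d ⟧ ≡ 0
⟦⟧-no (yes a) ¬a = contradiction a ¬a
⟦⟧-no (no _) _ = refl

∑-mono : ∀ {n} {f g : Fin n → ℕ} → (∀ i → f i ≤ g i) → sum f ≤ sum g
∑-mono {zero}  f≤g = z≤n
∑-mono {suc n} f≤g = +-mono-≤ (f≤g zero) (∑-mono (f≤g ∘ suc))

∑-single : ∀ {n} (i : Fin n) (f : Fin n → ℕ) → ∑[ j < n ] (⟦ j ≟ i ⟧ * f j) ≡ f i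
∑-single {suc n} zero f = begin
  f zero + 0 + ∑[ j < n ] 0  ≡⟨ cong₂ _+_ (+-identityʳ _) (sum-replicate-zero n) ⟩
  f zero + 0                 ≡⟨ +-identityʳ _ ⟩
  f zero                     ∎
  where open ≡-Reasoning
∑-single {suc n} (suc i) f = trans (sum-cong-≗ (λ j → cong (_* f (suc j)) (⟦⟧-suc j))) (∑-single i (f ∘ suc))
  where
  ⟦⟧-suc : ∀ j → ⟦ suc j ≟ suc i ⟧ ≡ ⟦ j ≟ i ⟧
  ⟦⟧-suc j with j ≟ i
  ... | yes _ = refl
  ... | no _  = refl

∑-next : (f : Fin (suc k) → ℕ) → sum (f ∘ next) ≡ sum f
∑-next {k} f = begin
  sum (f ∘ next)                                ≡⟨ sum-init-last (f ∘ next) ⟩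
  ∑[ i < k ] f (next (inject₁ i)) + f (next (fromℕ k))  ≡⟨ cong₂ _+_ (sum-cong-≗ (cong f ∘ next-inject₁)) (cong f next-fromℕ) ⟩
  ∑[ i < k ] f (suc i) + f zero                 ≡⟨ +-comm _ (f zero) ⟩
  sum f                                         ∎
  where
  open ≡-Reasoning
  next-inject₁ : ∀ i → next (inject₁ i) ≡ suc i
  next-inject₁ i = sym (CycleSucc⇒next (inj₁ (cong suc (sym (toℕ-inject₁ i)))))
  next-fromℕ : next (fromℕ k) ≡ zero
  next-fromℕ = sym (CycleSucc⇒next (inj₂ (cong suc (toℕ-fromℕ k) , refl)))

-- A sum over cyclically consecutive pairs may be indexed by either member; this moves a double
-- count from the heads of edges to their tails.
∑-next-prev : (g : Fin (suc k) → Fin (suc k) → ℕ) → ∑[ i < suc k ] g (next i) i ≡ ∑[ i < suc k ] g i (prev i)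
∑-next-prev g = trans (sum-cong-≗ (λ i → cong (g (next i)) (sym (prev-next i)))) (∑-next (λ i → g i (prev i)))

∑-prev-next : (g : Fin (suc k) → Fin (suc k) → ℕ) → ∑[ i < suc k ] g (prev i) i ≡ ∑[ i < suc k ] g i (next i)
∑-prev-next g = trans (sym (∑-next (λ i → g (prev i) i))) (sum-cong-≗ (λ i → cong (λ x → g x (next i)) (prev-next i)))

-- `2^-d` scaled by `2^M`. This is faithful only for `d ≤ M`; beyond, truncated subtraction makes it
-- 1, whence the side conditions of `weight-suc` and `weight-+`.
weight : ℕ → ℕ → ℕ
weight M d = 2 ^ (M ∸ d)

weight-antitone : ∀ M {d e} → d ≤ e → weight M e ≤ weight M d
weight-antitone M d≤e = ^-monoʳ-≤ 2 (∸-monoʳ-≤ M d≤e)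

weight-suc : ∀ {M d} → suc d ≤ M → weight M d ≡ 2 * weight M (suc d)
weight-suc d<M = cong (2 ^_) (+-∸-assoc 1 d<M)

weight-lipschitz : ∀ M {d e} → e ≤ suc d → weight M d ≤ 2 * weight M e
weight-lipschitz M {d} {e} e≤1+d = ≤-trans (go M d) (*-monoʳ-≤ 2 (weight-antitone M e≤1+d))
  where
  go : ∀ M d → weight M d ≤ 2 * weight M (suc d)
  go M d with suc d ≤? M
  ... | yes d<M = ≤-reflexive (weight-suc d<M)
  -- Here `M ≤ d`, so the left side is 1 and positivity of the right side is enough.
  ... | no d≮M rewrite m≤n⇒m∸n≡0 (s≤s⁻¹ (≰⇒> d≮M)) = >-nonZero⁻¹ (2 * weight M (suc d)) {{m*n≢0 2 _ {{_}} {{m^n≢0 2 (M ∸ suc d)}}}}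

weight-+ : ∀ {M N d e} → d ≤ M → e ≤ N → weight (M + N) (d + e) ≡ weight M d * weight N e
weight-+ {M} {N} {d} {e} d≤M e≤N = trans (cong (2 ^_) lemma) (^-distribˡ-+-* 2 (M ∸ d) (N ∸ e))
  where
  open ≡-Reasoning
  lemma : M + N ∸ (d + e) ≡ (M ∸ d) + (N ∸ e)
  lemma = begin
    M + N ∸ (d + e)    ≡⟨ ∸-+-assoc (M + N) d e ⟨
    M + N ∸ d ∸ e      ≡⟨ cong (_∸ e) (+-∸-comm N d≤M) ⟩
    (M ∸ d) + N ∸ e    ≡⟨ +-∸-assoc (M ∸ d) e≤N ⟩
    (M ∸ d) + (N ∸ e)  ∎

module CycleWeight (k : ℕ) where
  open CycleDistance k public

  κ : Fin (suc k) → Fin (suc k) → ℕ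
  κ i j = weight (suc k) (dist i j)

  -- An edge leading away from `i` carries the weight of its far end; the double counts below
  -- compare these amounts at both ends.
  outward : (i j j′ : Fin (suc k)) → ℕ
  outward i j j′ = ⟦ dist i j′ ≟ℕ suc (dist i j) ⟧ * κ i j′

  κ-refl : ∀ i → κ i i ≡ 2 ^ suc k
  κ-refl i = cong (weight (suc k)) (dist-refl i)

  2*outward≤κ : ∀ i j j′ → 2 * outward i j j′ ≤ κ i j
  2*outward≤κ i j j′ with dist i j′ ≟ℕ suc (dist i j)
  ... | yes e = ≤-reflexive (trans (cong (2 *_) (+-identityʳ (κ i j′))) (trans (cong (λ d → 2 * weight (suc k) d) e) (sym (weight-suc (subst (_≤ suc k) e (dist≤ i j′))))))
  ... | no _  = z≤n

  outward-inward : ∀ i j j′ → dist i j ≡ suc (dist i j′) → outward i j j′ ≡ 0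
  outward-inward i j j′ e = cong (_* κ i j′) (⟦⟧-no (_ ≟ℕ _)
    (λ e′ → <⇒≢ (m<n⇒m<1+n (≤-refl {suc (dist i j′)})) (trans e′ (cong suc e))))

  -- Away from `i` some neighbour lies inwards, so at most one of the two edges leads outwards. Only
  -- at `i` can both do so, which the indicator term pays for.
  outward-sum : ∀ i j → 2 * (outward i j (next j) + outward i j (prev j)) ≤ κ i j + ⟦ j ≟ i ⟧ * κ i j
  outward-sum i j with j ≟ i
  ... | yes _ = begin
    2 * (outward i j (next j) + outward i j (prev j))     ≡⟨ *-distribˡ-+ 2 (outward i j (next j)) _ ⟩
    2 * outward i j (next j) + 2 * outward i j (prev j)   ≤⟨ +-mono-≤ (2*outward≤κ i j _) (2*outward≤κ i j _) ⟩
    κ i j + κ i j                                         ≡⟨ cong (κ i j +_) (+-identityʳ (κ i j)) ⟨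
    κ i j + (κ i j + 0)                                   ∎
    where open ≤-Reasoning
  ... | no j≢i with dist-inward i j j≢i
  ...   | inj₁ e rewrite outward-inward i j (next j) e | +-identityʳ (κ i j) = 2*outward≤κ i j (prev j)
  ...   | inj₂ e rewrite outward-inward i j (prev j) e | +-identityʳ (κ i j) | +-identityʳ (outward i j (next j)) = 2*outward≤κ i j (next j)

  κ-inward : ∀ i j → κ i j ≤ ⟦ j ≟ i ⟧ * κ i j + (outward i (next j) j + outward i (prev j) j)
  κ-inward i j with j ≟ i
  ... | yes _ = ≤-trans (≤-reflexive (sym (+-identityʳ _))) (m≤m+n _ _)
  ... | no j≢i with dist-inward i j j≢i
  ...   | inj₁ e = ≤-trans (≤-reflexive (sym (trans (cong (_* κ i j) (⟦⟧-yes (_ ≟ℕ _) e)) (*-identityˡ _)))) (m≤m+n _ _)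
  ...   | inj₂ e = ≤-trans (≤-reflexive (sym (trans (cong (_* κ i j) (⟦⟧-yes (_ ≟ℕ _) e)) (*-identityˡ _)))) (m≤n+m _ (outward i (next j) j))

  -- Counting outward edges by far end and by near end gives `Σκ ≤ C + Σo` and `2 * Σo ≤ Σκ + C`,
  -- which combine to the bound. The constant 3 is the sum 1 + 2(1/2 + 1/4 + ...) over a doubly
  -- infinite path.
  ∑κ≤ : ∀ i → ∑[ j < suc k ] κ i j ≤ 3 * 2 ^ suc k
  ∑κ≤ i = +-cancelˡ-≤ Σκ Σκ (3 * C) (begin
    Σκ + Σκ                  ≡⟨ cong (Σκ +_) (+-identityʳ Σκ) ⟨
    2 * Σκ                   ≤⟨ *-monoʳ-≤ 2 step ⟩
    2 * (C + Σo)             ≡⟨ *-distribˡ-+ 2 C Σo ⟩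
    2 * C + 2 * Σo           ≤⟨ +-monoʳ-≤ (2 * C) step₂ ⟩
    2 * C + (Σκ + C)         ≡⟨ arith C Σκ ⟩
    Σκ + 3 * C               ∎)
    where
    open ≤-Reasoning
    arith : ∀ c s → 2 * c + (s + c) ≡ s + 3 * c
    arith = solve-∀
    C Σκ Σo : ℕ
    C = 2 ^ suc k
    Σκ = ∑[ j < suc k ] κ i j
    Σo = ∑[ j < suc k ] (outward i j (next j) + outward i j (prev j))
    Σself : ∑[ j < suc k ] (⟦ j ≟ i ⟧ * κ i j) ≡ C
    Σself = trans (∑-single i (κ i)) (κ-refl i)
    self o⁺ o⁻ : Fin (suc k) → ℕ
    self j = ⟦ j ≟ i ⟧ * κ i j
    o⁺ j = outward i j (next j)
    o⁻ j = outward i j (prev j)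
    reindex : ∑[ j < suc k ] (outward i (next j) j + outward i (prev j) j) ≡ Σo
    reindex = begin-equality
      ∑[ j < suc k ] (outward i (next j) j + outward i (prev j) j)
        ≡⟨ ∑-distrib-+ (λ j → outward i (next j) j) (λ j → outward i (prev j) j) ⟩
      ∑[ j < suc k ] outward i (next j) j + ∑[ j < suc k ] outward i (prev j) j
        ≡⟨ cong₂ _+_ (∑-next-prev (outward i)) (∑-prev-next (outward i)) ⟩
      sum o⁻ + sum o⁺
        ≡⟨ +-comm (sum o⁻) (sum o⁺) ⟩
      sum o⁺ + sum o⁻
        ≡⟨ ∑-distrib-+ o⁺ o⁻ ⟨
      Σo ∎
    step : Σκ ≤ C + Σo
    step = ≤-trans (∑-mono (κ-inward i))
             (≤-reflexive (trans (∑-distrib-+ self (λ j → outward i (next j) j + outward i (prev j) j)) (cong₂ _+_ Σself reindex)))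
    step₂ : 2 * Σo ≤ Σκ + C
    step₂ = begin
      2 * Σo   ≡⟨ *-distribˡ-sum 2 (λ j → outward i j (next j) + outward i j (prev j)) ⟩
      ∑[ j < suc k ] (2 * (outward i j (next j) + outward i j (prev j)))  ≤⟨ ∑-mono (outward-sum i) ⟩
      ∑[ j < suc k ] (κ i j + ⟦ j ≟ i ⟧ * κ i j)  ≡⟨ ∑-distrib-+ (κ i) self ⟩
      Σκ + ∑[ j < suc k ] (⟦ j ≟ i ⟧ * κ i j)     ≡⟨ cong (Σκ +_) Σself ⟩
      Σκ + C ∎

-- Sums and weights on the torus

module _ {m n : ℕ} where

  ∑ⱽ : (Fin m × Fin n → ℕ) → ℕ
  ∑ⱽ f = ∑[ a < m ] ∑[ b < n ] f (a , b)

  ∑ⱽ-mono : ∀ {f g} → (∀ x → f x ≤ g x) → ∑ⱽ f ≤ ∑ⱽ g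
  ∑ⱽ-mono f≤g = ∑-mono λ a → ∑-mono λ b → f≤g (a , b)

  ∑ⱽ-cong : ∀ {f g} → (∀ x → f x ≡ g x) → ∑ⱽ f ≡ ∑ⱽ g
  ∑ⱽ-cong f≡g = sum-cong-≗ λ a → sum-cong-≗ λ b → f≡g (a , b)

  ∑ⱽ-+ : ∀ f g → ∑ⱽ (λ x → f x + g x) ≡ ∑ⱽ f + ∑ⱽ g
  ∑ⱽ-+ f g = trans (sum-cong-≗ λ a → ∑-distrib-+ (λ b → f (a , b)) (λ b → g (a , b)))
                   (∑-distrib-+ (λ a → ∑[ b < n ] f (a , b)) (λ a → ∑[ b < n ] g (a , b)))

  ∑ⱽ-*ˡ : ∀ c f → ∑ⱽ (λ x → c * f x) ≡ c * ∑ⱽ f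
  ∑ⱽ-*ˡ c f = sym (trans (*-distribˡ-sum c (λ a → ∑[ b < n ] f (a , b)))
                         (sum-cong-≗ λ a → *-distribˡ-sum c (λ b → f (a , b))))

  ∑ⱽ-product : ∀ (f : Fin m → ℕ) (g : Fin n → ℕ) → ∑ⱽ (λ (a , b) → f a * g b) ≡ sum f * sum g
  ∑ⱽ-product f g = trans (sum-cong-≗ λ a → sym (*-distribˡ-sum (f a) g)) (sym (*-distribʳ-sum (sum g) f))

  ∑ⱽ-∑-comm : ∀ {p} (f : Fin m × Fin n → Fin p → ℕ) →
    ∑ⱽ (λ x → ∑[ c < p ] f x c) ≡ ∑[ c < p ] ∑ⱽ (λ x → f x c)
  ∑ⱽ-∑-comm f = trans (sum-cong-≗ λ a → ∑-comm (λ b c → f (a , b) c)) (∑-comm (λ a c → ∑[ b < n ] f (a , b) c))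

  infix 4 _≟ⱽ_
  _≟ⱽ_ : (x y : Fin m × Fin n) → Dec (x ≡ y)
  _≟ⱽ_ = ≡-dec _≟_ _≟_

  ∑ⱽ-single : ∀ u (f : Fin m × Fin n → ℕ) → ∑ⱽ (λ x → ⟦ x ≟ⱽ u ⟧ * f x) ≡ f u
  ∑ⱽ-single (i , j) f = begin
    ∑ⱽ (λ x → ⟦ x ≟ⱽ (i , j) ⟧ * f x)                            ≡⟨ ∑ⱽ-cong split ⟩
    ∑[ a < m ] ∑[ b < n ] (⟦ a ≟ i ⟧ * (⟦ b ≟ j ⟧ * f (a , b)))  ≡⟨ sum-cong-≗ (λ a → *-distribˡ-sum ⟦ a ≟ i ⟧ (λ b → ⟦ b ≟ j ⟧ * f (a , b))) ⟨
    ∑[ a < m ] (⟦ a ≟ i ⟧ * ∑[ b < n ] (⟦ b ≟ j ⟧ * f (a , b)))  ≡⟨ ∑-single i (λ a → ∑[ b < n ] (⟦ b ≟ j ⟧ * f (a , b))) ⟩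
    ∑[ b < n ] (⟦ b ≟ j ⟧ * f (i , b))                          ≡⟨ ∑-single j (λ b → f (i , b)) ⟩
    f (i , j) ∎
    where
    open ≡-Reasoning
    split : ∀ x → ⟦ x ≟ⱽ (i , j) ⟧ * f x ≡ ⟦ proj₁ x ≟ i ⟧ * (⟦ proj₂ x ≟ j ⟧ * f x)
    split (a , b) with a ≟ i
    ... | no _ = refl
    ... | yes refl with b ≟ j
    ...   | no _     = refl
    ...   | yes refl = sym (*-identityˡ _)

  term≤∑ⱽ : ∀ u (f : Fin m × Fin n → ℕ) → f u ≤ ∑ⱽ f
  term≤∑ⱽ u f = ≤-trans (≤-reflexive (sym (∑ⱽ-single u f)))
    (∑ⱽ-mono λ x → ≤-trans (*-monoˡ-≤ (f x) (⟦⟧≤1 (x ≟ⱽ u))) (≤-reflexive (*-identityˡ (f x))))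

  ∑ⱽ-const : ∀ c → ∑ⱽ (λ _ → c) ≡ m * n * c
  ∑ⱽ-const c = trans (∑-const m (sum {n} (λ _ → c))) (trans (cong (m *_) (∑-const n c)) (sym (*-assoc m n c)))
    where
    ∑-const : ∀ p c → sum {p} (λ _ → c) ≡ p * c
    ∑-const zero    c = refl
    ∑-const (suc p) c = cong (c +_) (∑-const p c)

  size≡∑ⱽ : (P : Distribution (Torus m n)) → size m n P ≡ ∑ⱽ P
  size≡∑ⱽ P = trans (sum-map-tabulate m (λ i → sumᴸ (mapᴸ (λ j → P (i , j)) (allFinᴸ n))) id)
                    (sum-cong-≗ λ a → sum-map-tabulate n (λ j → P (a , j)) id)
    where
    sum-map-tabulate : ∀ p {A : Set} (f : A → ℕ) (g : Fin p → A) → sumᴸ (mapᴸ f (tabulateᴸ g)) ≡ sum (f ∘ g)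
    sum-map-tabulate zero    f g = refl
    sum-map-tabulate (suc p) f g = cong (f (g zero) +_) (sum-map-tabulate p f (g ∘ suc))

∑ⱽ-comm : ∀ {m n p q} (f : Fin m × Fin n → Fin p × Fin q → ℕ) →
  ∑ⱽ (λ x → ∑ⱽ (f x)) ≡ ∑ⱽ (λ y → ∑ⱽ (λ x → f x y))
∑ⱽ-comm {q = q} f = trans (∑ⱽ-∑-comm (λ x c → ∑[ e < q ] f x (c , e)))
  (sum-cong-≗ λ c → ∑ⱽ-∑-comm (λ x e → f x (c , e)))

module TorusWeight (k l : ℕ) where

  module C₁ = CycleWeight k
  module C₂ = CycleWeight l

  G : Graph
  G = Torus (suc k) (suc l)

  -- Adding the two exponents makes `K` the product of the cycle weights; `E` is the scaled 1.
  M E : ℕ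
  M = suc k + suc l
  E = 2 ^ M

  dist : V G → V G → ℕ
  dist (i , j) (a , b) = C₁.dist i a + C₂.dist j b

  K : V G → V G → ℕ
  K u v = weight M (dist u v)

  K≡ : ∀ i j a b → K (i , j) (a , b) ≡ C₁.κ i a * C₂.κ j b
  K≡ i j a b = weight-+ (C₁.dist≤ i a) (C₂.dist≤ j b)

  dist-refl : ∀ u → dist u u ≡ 0
  dist-refl (i , j) = cong₂ _+_ (C₁.dist-refl i) (C₂.dist-refl j)

  dist-sym : ∀ u v → dist u v ≡ dist v u
  dist-sym (i , j) (a , b) = cong₂ _+_ (C₁.dist-sym i a) (C₂.dist-sym j b)

  K-refl : ∀ u → K u u ≡ E
  K-refl u = cong (weight M) (dist-refl u)

  E≡ : E ≡ 2 ^ suc k * 2 ^ suc l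
  E≡ = ^-distribˡ-+-* 2 (suc k) (suc l)

  Adj-sym : ∀ {x y} → Adj G x y → Adj G y x
  Adj-sym (inj₁ (inj₁ s , e)) = inj₁ (inj₂ s , sym e)
  Adj-sym (inj₁ (inj₂ s , e)) = inj₁ (inj₁ s , sym e)
  Adj-sym (inj₂ (inj₁ s , e)) = inj₂ (inj₂ s , sym e)
  Adj-sym (inj₂ (inj₂ s , e)) = inj₂ (inj₁ s , sym e)

  dist-lipschitz : ∀ u {x y} → Adj G x y → dist u y ≤ suc (dist u x)
  dist-lipschitz (i , j) {a , b} (inj₁ (inj₁ s , refl)) rewrite CycleSucc⇒next s =
    +-monoˡ-≤ (C₂.dist j b) (proj₁ (C₁.dist-next-lipschitz i a))
  dist-lipschitz (i , j) {a , b} {a′ , _} (inj₁ (inj₂ s , refl)) rewrite CycleSucc⇒next s =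
    +-monoˡ-≤ (C₂.dist j b) (proj₂ (C₁.dist-next-lipschitz i a′))
  dist-lipschitz (i , j) {a , b} (inj₂ (inj₁ s , refl)) rewrite CycleSucc⇒next s =
    ≤-trans (+-monoʳ-≤ (C₁.dist i a) (proj₁ (C₂.dist-next-lipschitz j b))) (≤-reflexive (+-suc _ _))
  dist-lipschitz (i , j) {a , b} {_ , b′} (inj₂ (inj₂ s , refl)) rewrite CycleSucc⇒next s =
    ≤-trans (+-monoʳ-≤ (C₁.dist i a) (proj₂ (C₂.dist-next-lipschitz j b′))) (≤-reflexive (+-suc _ _))

  dist-lipschitzˡ : ∀ {u w} v → Adj G u w → dist u v ≤ suc (dist w v)
  dist-lipschitzˡ {u} {w} v u~w = subst₂ (λ a b → a ≤ suc b) (dist-sym v u) (dist-sym v w)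
    (dist-lipschitz v (Adj-sym u~w))

  ∑K≤ : ∀ u → ∑ⱽ (K u) ≤ 9 * E
  ∑K≤ (i , j) = begin
    ∑ⱽ (K (i , j))                               ≡⟨ ∑ⱽ-cong (λ (a , b) → K≡ i j a b) ⟩
    ∑ⱽ (λ (a , b) → C₁.κ i a * C₂.κ j b)         ≡⟨ ∑ⱽ-product (C₁.κ i) (C₂.κ j) ⟩
    sum (C₁.κ i) * sum (C₂.κ j)                  ≤⟨ *-mono-≤ (C₁.∑κ≤ i) (C₂.∑κ≤ j) ⟩
    3 * 2 ^ suc k * (3 * 2 ^ suc l)              ≡⟨ arith (2 ^ suc k) (2 ^ suc l) ⟩
    9 * (2 ^ suc k * 2 ^ suc l)                  ≡⟨ cong (9 *_) E≡ ⟨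
    9 * E                                        ∎
    where
    open ≤-Reasoning
    arith : ∀ a b → 3 * a * (3 * b) ≡ 9 * (a * b)
    arith = solve-∀

  -- Double counting along outward edges: every vertex y ≠ u with g y + τ y = 1 has a
  -- neighbour in g one step closer to u, whereas the vertices just beyond x weigh at most
  -- K u x in total, with a surplus of ½ K u x for each coordinate x shares with u.
  module Boundary (u : V G) (g τ : V G → ℕ)
    (g+τ≤1 : ∀ x → g x + τ x ≤ 1)
    (pred : ∀ y → 1 ≤ g y + τ y → y ≡ u ⊎ ∃ λ p → Adj G p y × 1 ≤ g p × dist u y ≡ suc (dist u p))
    where

    i : Fin (suc k)
    i = proj₁ u
    j : Fin (suc l)
    j = proj₂ u

    -- The weight carried to `(a , b)` by the edge from `(a′ , b)`, present only if that tail lies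
    -- in `g` and the edge leads away from `u`. `in₂` is the analogue in the second coordinate.
    in₁ : Fin (suc k) → V G → ℕ
    in₁ a′ (a , b) = g (a′ , b) * (C₁.outward i a′ a * C₂.κ j b)
    in₂ : Fin (suc l) → V G → ℕ
    in₂ b′ (a , b) = g (a , b′) * (C₁.κ i a * C₂.outward j b′ b)

    inflow outflow : V G → ℕ
    inflow (a , b) = (in₁ (next a) (a , b) + in₁ (prev a) (a , b)) + (in₂ (next b) (a , b) + in₂ (prev b) (a , b))
    outflow (a , b) = (in₁ a (next a , b) + in₁ a (prev a , b)) + (in₂ b (a , next b) + in₂ b (a , prev b))

    ∑-inflow : ∑ⱽ inflow ≡ ∑ⱽ outflow
    ∑-inflow = begin
      ∑ⱽ inflow
        ≡⟨ split (λ (a , b) → in₁ (next a) (a , b)) (λ (a , b) → in₁ (prev a) (a , b))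
                 (λ (a , b) → in₂ (next b) (a , b)) (λ (a , b) → in₂ (prev b) (a , b)) ⟩
      _ ≡⟨ cong₂ _+_ (cong₂ _+_ (∑-next-prev (λ a′ a → ∑[ b < suc l ] in₁ a′ (a , b)))
                                (∑-prev-next (λ a′ a → ∑[ b < suc l ] in₁ a′ (a , b))))
                     (cong₂ _+_ (sum-cong-≗ λ a → ∑-next-prev (λ b′ b → in₂ b′ (a , b)))
                                (sum-cong-≗ λ a → ∑-prev-next (λ b′ b → in₂ b′ (a , b)))) ⟩
      -- Reindexing by the tail exchanges `next` and `prev`, so the summands return in swapped
      -- order.
      _ ≡⟨ cong₂ _+_ (+-comm (∑ⱽ (λ (a , b) → in₁ a (prev a , b))) _) (+-comm (∑ⱽ (λ (a , b) → in₂ b (a , prev b))) _) ⟩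
      _ ≡⟨ split (λ (a , b) → in₁ a (next a , b)) (λ (a , b) → in₁ a (prev a , b))
                 (λ (a , b) → in₂ b (a , next b)) (λ (a , b) → in₂ b (a , prev b)) ⟨
      ∑ⱽ outflow ∎
      where
      open ≡-Reasoning
      split : ∀ (p q r s : V G → ℕ) → ∑ⱽ (λ x → (p x + q x) + (r x + s x)) ≡ (∑ⱽ p + ∑ⱽ q) + (∑ⱽ r + ∑ⱽ s)
      split p q r s = trans (∑ⱽ-+ (λ x → p x + q x) (λ x → r x + s x)) (cong₂ _+_ (∑ⱽ-+ p q) (∑ⱽ-+ r s))

    here : V G → ℕ
    here x = ⟦ x ≟ⱽ u ⟧ * K u x

    ∑-here : ∑ⱽ here ≡ E
    ∑-here = trans (∑ⱽ-single u (K u)) (K-refl u)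

    outward≡κ₁ : ∀ a a′ b → dist u (a , b) ≡ suc (dist u (a′ , b)) → C₁.outward i a′ a ≡ C₁.κ i a
    outward≡κ₁ a a′ b e = trans (cong (_* C₁.κ i a) (⟦⟧-yes (_ ≟ℕ _) (+-cancelʳ-≡ (C₂.dist j b) _ _ e))) (*-identityˡ _)

    outward≡κ₂ : ∀ a b b′ → dist u (a , b) ≡ suc (dist u (a , b′)) → C₂.outward j b′ b ≡ C₂.κ j b
    outward≡κ₂ a b b′ e = trans (cong (_* C₂.κ j b) (⟦⟧-yes (_ ≟ℕ _)
      (+-cancelˡ-≡ (C₁.dist i a) _ _ (trans e (sym (+-suc _ _)))))) (*-identityˡ _)

    K≤in₁ : ∀ a a′ b → 1 ≤ g (a′ , b) → dist u (a , b) ≡ suc (dist u (a′ , b)) → K u (a , b) ≤ in₁ a′ (a , b)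
    K≤in₁ a a′ b 1≤g e = begin
      K u (a , b)                                    ≡⟨ K≡ i j a b ⟩
      C₁.κ i a * C₂.κ j b                            ≡⟨ cong (_* C₂.κ j b) (outward≡κ₁ a a′ b e) ⟨
      C₁.outward i a′ a * C₂.κ j b                   ≤⟨ m≤n*m _ (g (a′ , b)) {{>-nonZero 1≤g}} ⟩
      in₁ a′ (a , b)                                 ∎
      where open ≤-Reasoning

    K≤in₂ : ∀ a b b′ → 1 ≤ g (a , b′) → dist u (a , b) ≡ suc (dist u (a , b′)) → K u (a , b) ≤ in₂ b′ (a , b)
    K≤in₂ a b b′ 1≤g e = begin
      K u (a , b)                                    ≡⟨ K≡ i j a b ⟩
      C₁.κ i a * C₂.κ j b                            ≡⟨ cong (C₁.κ i a *_) (outward≡κ₂ a b b′ e) ⟨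
      C₁.κ i a * C₂.outward j b′ b                   ≤⟨ m≤n*m _ (g (a , b′)) {{>-nonZero 1≤g}} ⟩
      in₂ b′ (a , b)                                 ∎
      where open ≤-Reasoning

    CycleSucc⇒prev : ∀ {p} {a b : Fin (suc p)} → CycleSucc (suc p) a b → a ≡ prev b
    CycleSucc⇒prev s = trans (sym (prev-next _)) (cong prev (sym (CycleSucc⇒next s)))

    -- The single edge from the predecessor already carries all of `K u y`.
    K≤inflow : ∀ y → (∃ λ p → Adj G p y × 1 ≤ g p × dist u y ≡ suc (dist u p)) → K u y ≤ inflow y
    K≤inflow (a , b) ((a′ , _) , inj₁ (inj₁ s , refl) , 1≤g , e) with refl ← CycleSucc⇒prev s =
      ≤-trans (K≤in₁ a a′ b 1≤g e) (≤-trans (m≤n+m _ (in₁ (next a) (a , b))) (m≤m+n _ _))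
    K≤inflow (a , b) ((a′ , _) , inj₁ (inj₂ s , refl) , 1≤g , e) with refl ← CycleSucc⇒next s =
      ≤-trans (K≤in₁ a a′ b 1≤g e) (≤-trans (m≤m+n _ _) (m≤m+n _ _))
    K≤inflow (a , b) ((_ , b′) , inj₂ (inj₁ s , refl) , 1≤g , e) with refl ← CycleSucc⇒prev s =
      ≤-trans (K≤in₂ a b b′ 1≤g e) (≤-trans (m≤n+m _ (in₂ (next b) (a , b))) (m≤n+m _ (in₁ (next a) (a , b) + in₁ (prev a) (a , b))))
    K≤inflow (a , b) ((_ , b′) , inj₂ (inj₂ s , refl) , 1≤g , e) with refl ← CycleSucc⇒next s =
      ≤-trans (K≤in₂ a b b′ 1≤g e) (≤-trans (m≤m+n _ _) (m≤n+m _ (in₁ (next a) (a , b) + in₁ (prev a) (a , b))))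

    -- Only `u` may lack a predecessor; `here` supplies its weight.
    covered : ∀ y → (g y + τ y) * K u y ≤ here y + inflow y
    covered y with g y + τ y | g+τ≤1 y | pred y
    ... | zero | _ | _ = z≤n
    ... | suc zero | _ | p with p ≤-refl
    ...   | inj₁ refl = ≤-trans (≤-reflexive (sym here≡)) (m≤m+n _ _)
      where
      here≡ : here u ≡ 1 * K u u
      here≡ = cong (_* K u u) (⟦⟧-yes (u ≟ⱽ u) refl)
    ...   | inj₂ q = ≤-trans (≤-reflexive (*-identityˡ (K u y))) (≤-trans (K≤inflow y q) (m≤n+m _ (here y)))
    covered y | suc (suc _) | s≤s () | _

    -- The surplus of `outward-sum` at the vertices sharing a coordinate with `u`, where both edges
    -- in that direction may lead outwards.
    axis₁ axis₂ : V G → ℕ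
    axis₁ (a , b) = (⟦ a ≟ i ⟧ * C₁.κ i a) * C₂.κ j b
    axis₂ (a , b) = C₁.κ i a * (⟦ b ≟ j ⟧ * C₂.κ j b)

    outflow≤ : ∀ x → 2 * outflow x ≤ 2 * (g x * K u x) + (axis₁ x + axis₂ x)
    outflow≤ (a , b) = begin
      2 * outflow (a , b)
        ≡⟨ arith₁ γ p⁺ p⁻ q⁺ q⁻ x y ⟩
      γ * (2 * (p⁺ + p⁻) * y + x * (2 * (q⁺ + q⁻)))
        ≤⟨ *-monoʳ-≤ γ (+-mono-≤ (*-monoˡ-≤ y (C₁.outward-sum i a)) (*-monoʳ-≤ x (C₂.outward-sum j b))) ⟩
      γ * ((x + α) * y + x * (y + β))
        ≡⟨ arith₂ γ x y α β ⟩
      2 * (γ * (x * y)) + γ * (α * y + x * β)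
        ≤⟨ +-monoʳ-≤ (2 * (γ * (x * y))) (≤-trans (*-monoˡ-≤ _ γ≤1) (≤-reflexive (*-identityˡ _))) ⟩
      2 * (γ * (x * y)) + (α * y + x * β)
        ≡⟨ cong (λ z → 2 * (γ * z) + (α * y + x * β)) (K≡ i j a b) ⟨
      2 * (γ * K u (a , b)) + (axis₁ (a , b) + axis₂ (a , b)) ∎
      where
      open ≤-Reasoning
      γ x y α β p⁺ p⁻ q⁺ q⁻ : ℕ
      γ = g (a , b)
      x = C₁.κ i a
      y = C₂.κ j b
      α = ⟦ a ≟ i ⟧ * x
      β = ⟦ b ≟ j ⟧ * y
      p⁺ = C₁.outward i a (next a)
      p⁻ = C₁.outward i a (prev a)
      q⁺ = C₂.outward j b (next b)
      q⁻ = C₂.outward j b (prev b)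
      γ≤1 : γ ≤ 1
      γ≤1 = ≤-trans (m≤m+n γ (τ (a , b))) (g+τ≤1 (a , b))
      arith₁ : ∀ γ p⁺ p⁻ q⁺ q⁻ x y →
        2 * ((γ * (p⁺ * y) + γ * (p⁻ * y)) + (γ * (x * q⁺) + γ * (x * q⁻))) ≡
        γ * (2 * (p⁺ + p⁻) * y + x * (2 * (q⁺ + q⁻)))
      arith₁ = solve-∀
      arith₂ : ∀ γ x y α β → γ * ((x + α) * y + x * (y + β)) ≡ 2 * (γ * (x * y)) + γ * (α * y + x * β)
      arith₂ = solve-∀

    ∑axis₁ : ∑ⱽ axis₁ ≤ 3 * E
    ∑axis₁ = begin
      ∑ⱽ axis₁                                                        ≡⟨ ∑ⱽ-product (λ a → ⟦ a ≟ i ⟧ * C₁.κ i a) (C₂.κ j) ⟩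
      ∑[ a < suc k ] (⟦ a ≟ i ⟧ * C₁.κ i a) * sum (C₂.κ j)            ≡⟨ cong (_* sum (C₂.κ j)) (trans (∑-single i (C₁.κ i)) (C₁.κ-refl i)) ⟩
      2 ^ suc k * sum (C₂.κ j)                                        ≤⟨ *-monoʳ-≤ (2 ^ suc k) (C₂.∑κ≤ j) ⟩
      2 ^ suc k * (3 * 2 ^ suc l)                                     ≡⟨ arith (2 ^ suc k) (2 ^ suc l) ⟩
      3 * (2 ^ suc k * 2 ^ suc l)                                     ≡⟨ cong (3 *_) E≡ ⟨
      3 * E ∎
      where
      open ≤-Reasoning
      arith : ∀ a b → a * (3 * b) ≡ 3 * (a * b)
      arith = solve-∀

    ∑axis₂ : ∑ⱽ axis₂ ≤ 3 * E
    ∑axis₂ = begin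
      ∑ⱽ axis₂                                                        ≡⟨ ∑ⱽ-product (C₁.κ i) (λ b → ⟦ b ≟ j ⟧ * C₂.κ j b) ⟩
      sum (C₁.κ i) * ∑[ b < suc l ] (⟦ b ≟ j ⟧ * C₂.κ j b)            ≡⟨ cong (sum (C₁.κ i) *_) (trans (∑-single j (C₂.κ j)) (C₂.κ-refl j)) ⟩
      sum (C₁.κ i) * 2 ^ suc l                                        ≤⟨ *-monoˡ-≤ (2 ^ suc l) (C₁.∑κ≤ i) ⟩
      3 * 2 ^ suc k * 2 ^ suc l                                       ≡⟨ *-assoc 3 (2 ^ suc k) (2 ^ suc l) ⟩
      3 * (2 ^ suc k * 2 ^ suc l)                                     ≡⟨ cong (3 *_) E≡ ⟨
      3 * E ∎
      where open ≤-Reasoning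

    -- By the flow identity, twice the weight of `g` and `τ` together is at most `2 * E` for `u`,
    -- plus twice the weight of `g`, plus `3 * E` for each axis. The `g` terms cancel, leaving
    -- `8 * E` for twice the weight of `τ`.
    ∑τK≤ : ∑ⱽ (λ x → τ x * K u x) ≤ 4 * E
    ∑τK≤ = *-cancelˡ-≤ 2 (+-cancelˡ-≤ (2 * Σg) (2 * Στ) (2 * (4 * E)) (begin
      2 * Σg + 2 * Στ                        ≡⟨ *-distribˡ-+ 2 Σg Στ ⟨
      2 * (Σg + Στ)                          ≡⟨ cong (2 *_) (trans (∑ⱽ-cong (λ x → *-distribʳ-+ (K u x) (g x) (τ x))) (∑ⱽ-+ gK τK)) ⟨
      2 * ∑ⱽ (λ x → (g x + τ x) * K u x)     ≤⟨ *-monoʳ-≤ 2 (∑ⱽ-mono covered) ⟩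
      2 * ∑ⱽ (λ x → here x + inflow x)       ≡⟨ cong (2 *_) (trans (∑ⱽ-+ here inflow) (cong₂ _+_ ∑-here ∑-inflow)) ⟩
      2 * (E + ∑ⱽ outflow)                   ≡⟨ *-distribˡ-+ 2 E (∑ⱽ outflow) ⟩
      2 * E + 2 * ∑ⱽ outflow                 ≡⟨ cong (2 * E +_) (∑ⱽ-*ˡ 2 outflow) ⟨
      2 * E + ∑ⱽ (λ x → 2 * outflow x)       ≤⟨ +-monoʳ-≤ (2 * E) (∑ⱽ-mono outflow≤) ⟩
      2 * E + ∑ⱽ (λ x → 2 * gK x + (axis₁ x + axis₂ x))
        ≡⟨ cong (2 * E +_) (trans (∑ⱽ-+ (λ x → 2 * gK x) (λ x → axis₁ x + axis₂ x)) (cong₂ _+_ (∑ⱽ-*ˡ 2 gK) (∑ⱽ-+ axis₁ axis₂))) ⟩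
      2 * E + (2 * Σg + (∑ⱽ axis₁ + ∑ⱽ axis₂))
        ≤⟨ +-monoʳ-≤ (2 * E) (+-monoʳ-≤ (2 * Σg) (+-mono-≤ ∑axis₁ ∑axis₂)) ⟩
      2 * E + (2 * Σg + (3 * E + 3 * E))     ≡⟨ arith E Σg ⟩
      2 * Σg + 2 * (4 * E)                   ∎))
      where
      open ≤-Reasoning
      gK τK : V G → ℕ
      gK x = g x * K u x
      τK x = τ x * K u x
      Σg Στ : ℕ
      Σg = ∑ⱽ gK
      Στ = ∑ⱽ τK
      arith : ∀ e s → 2 * e + (2 * s + (3 * e + 3 * e)) ≡ 2 * s + 2 * (4 * e)
      arith = solve-∀

-- Pebbling

module Pebbling (k l : ℕ) (P : Distribution (Torus (suc k) (suc l))) where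

  open TorusWeight k l

  Rich : V G → Set
  Rich v = ∃ λ Q → Moves G P Q × 2 ≤ Q v

  data Walk : ℕ → V G → V G → Set where
    halt : ∀ {u} → Rich u → Walk 0 u u
    step : ∀ {s u w v} → Rich u → Adj G u w → Walk s w v → Walk (suc s) u v

  Geodesic : V G → V G → Set
  Geodesic u v = Walk (dist u v) u v

  target-rich : ∀ {s u v} → Walk s u v → Rich v
  target-rich (halt r)     = r
  target-rich (step _ _ w) = target-rich w

  -- `dist` is given by a formula; this bound shows that walks of that length are indeed shortest.
  dist≤length : ∀ {s u v} → Walk s u v → dist u v ≤ s
  dist≤length {u = u} (halt _) = ≤-reflexive (dist-refl u)
  dist≤length {v = v} (step _ u~w walk) = ≤-trans (dist-lipschitzˡ v u~w) (s≤s (dist≤length walk))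

  -- Walks are built from the source, as `ψ-step` requires, whereas the double count needs their
  -- last edge.
  unsnoc : ∀ {s u v} → Walk (suc s) u v → ∃ λ p → Walk s u p × Adj G p v
  unsnoc (step r u~w (halt _)) = _ , halt r , u~w
  unsnoc (step r u~w walk@(step _ _ _)) with p , walk′ , p~v ← unsnoc walk = p , step r u~w walk′ , p~v

  -- A geodesic stays geodesic without its last edge: by the Lipschitz bound the remaining length is
  -- at most `dist u p`, and no walk is shorter.
  geodesic-pred : ∀ {u y} → Geodesic u y → y ≡ u ⊎ ∃ λ p → Adj G p y × Geodesic u p × dist u y ≡ suc (dist u p)
  geodesic-pred {u} {y} = go refl
    where
    go : ∀ {s} → dist u y ≡ s → Walk s u y → y ≡ u ⊎ ∃ λ p → Adj G p y × Geodesic u p × dist u y ≡ suc (dist u p)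
    go {zero} _ (halt _) = inj₁ refl
    go {suc s} e walk with p , walk′ , p~y ← unsnoc walk =
      inj₂ (p , p~y , subst (λ s → Walk s u p) s≡ walk′ , trans e (cong suc s≡))
      where
      s≡ : s ≡ dist u p
      s≡ = ≤-antisym (s≤s⁻¹ (subst (_≤ suc (dist u p)) e (dist-lipschitz u p~y))) (dist≤length walk′)

  -- `near` stores a choice of the vertex called v(x) above. Poverty is recorded in the last two
  -- cases because geodesics end at rich vertices, so a poor `x` is never the end of one.
  data Status (x : V G) : Set where
    rich    : Rich x → Status x
    near    : ¬ Rich x → ∀ v → Rich v → Adj G v x → Status x
    pebbled : ¬ Rich x → 1 ≤ P x → Status x

  mover-rich : ∀ {Q Q′} → Moves G P Q → (mv : Move G Q Q′) → Rich (Move.u mv)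
  mover-rich {Q} {Q′} P⟶Q mv = Q , P⟶Q , ≤-trans (m≤n+m 2 (Q′ (Move.u mv))) (≤-reflexive (Move.at-u mv))

  -- Trace a pebble on `x` back: either `x` had one at the start, or a move brought one from a
  -- neighbour, which is then rich. The moves from `P` to `Q₀` are carried along because richness is
  -- measured from `P`.
  origin : ∀ {Q₀ Q} → Moves G P Q₀ → Moves G Q₀ Q → ∀ x → 1 ≤ Q x →
    1 ≤ Q₀ x ⊎ ∃ λ v → Rich v × Adj G v x
  origin _ ε x 1≤Q = inj₁ 1≤Q
  origin {Q₀} P⟶Q₀ (_◅_ {j = Q₁} mv mvs) x 1≤Q with origin (P⟶Q₀ ◅◅ mv ◅ ε) mvs x 1≤Q
  ... | inj₂ v = inj₂ v
  ... | inj₁ 1≤Q₁ with x ≟ⱽ Move.v mv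
  ...   | yes refl = inj₂ (Move.u mv , mover-rich P⟶Q₀ mv , Move.adj mv)
  ...   | no x≢v with x ≟ⱽ Move.u mv
  ...     | yes refl = inj₁ (≤-trans 1≤Q₁ (≤-trans (m≤m+n _ 2) (≤-reflexive (Move.at-u mv))))
  ...     | no x≢u = inj₁ (subst (1 ≤_) (Move.others mv x x≢u x≢v) 1≤Q₁)

  -- Potentials and charging, with richness and geodesics decided

  module Classical (rich? : ∀ v → Dec (Rich v)) (geodesic? : ∀ u v → Dec (Geodesic u v)) where

    status : ∀ x → Reachable G P x → Status x
    status x (Q , P⟶Q , 1≤Q) with rich? x
    ... | yes r = rich r
    ... | no ¬r with origin ε P⟶Q x 1≤Q
    ...   | inj₁ 1≤P = pebbled ¬r 1≤P
    ...   | inj₂ (v , rv , v~x) = near ¬r v rv v~x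

    -- Halving the weight of pairs not joined by a geodesic through rich vertices keeps
    -- ψ at most doubling along a move (ψ-step).
    ψ χ : V G → V G → ℕ
    ψ u v = (1 + ⟦ geodesic? u v ⟧) * K u v
    χ u v = ⟦ rich? u ⟧ * ψ u v

    K≤ψ : ∀ u v → K u v ≤ ψ u v
    K≤ψ u v = m≤m+n (K u v) _

    ψ≤2K : ∀ u v → ψ u v ≤ 2 * K u v
    ψ≤2K u v = *-monoˡ-≤ (K u v) (s≤s (⟦⟧≤1 (geodesic? u v)))

    χ≤ψ : ∀ u v → χ u v ≤ ψ u v
    χ≤ψ u v = ≤-trans (*-monoˡ-≤ (ψ u v) (⟦⟧≤1 (rich? u))) (≤-reflexive (*-identityˡ _))

    ψ-geodesic : ∀ {u v} → Geodesic u v → ψ u v ≡ 2 * K u v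
    ψ-geodesic {u} {v} γ = cong (λ b → (1 + b) * K u v) (⟦⟧-yes (geodesic? u v) γ)

    -- If `w` has a geodesic to `v` and `u` is one step farther, prepending `u` gives a geodesic
    -- too, so only `K` halves. If `u` is no farther, `K` does not drop and the possible loss of the
    -- factor 2 is affordable. Without a geodesic from `w`, again at most the halving of `K` counts.
    ψ-step : ∀ {u w} v → Rich u → Adj G u w → ψ w v ≤ 2 * ψ u v
    ψ-step {u} {w} v r u~w with geodesic? w v
    ... | no _ = ≤-trans (≤-reflexive (*-identityˡ (K w v)))
                   (≤-trans (weight-lipschitz M (dist-lipschitzˡ v u~w)) (*-monoʳ-≤ 2 (K≤ψ u v)))
    ... | yes γ with dist u v ≟ℕ suc (dist w v)
    ...   | yes e = *-monoʳ-≤ 2 (≤-trans (weight-lipschitz M (≤-reflexive e))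
                      (≤-reflexive (sym (ψ-geodesic (subst (λ s → Walk s u v) (sym e) (step r u~w γ))))))
    ...   | no ne = *-monoʳ-≤ 2 (≤-trans (weight-antitone M (s≤s⁻¹ (≤∧≢⇒< (dist-lipschitzˡ v u~w) ne))) (K≤ψ u v))

    χ-step : ∀ {u w} v → Rich u → Adj G u w → χ w v ≤ 2 * χ u v
    χ-step {u} {w} v r u~w = begin
      χ w v      ≤⟨ χ≤ψ w v ⟩
      ψ w v      ≤⟨ ψ-step v r u~w ⟩
      2 * ψ u v  ≡⟨ cong (2 *_) (trans (cong (_* ψ u v) (⟦⟧-yes (rich? u) r)) (*-identityˡ _)) ⟨
      2 * χ u v  ∎
      where open ≤-Reasoning

    Φ : V G → Distribution G → ℕ
    Φ v Q = ∑ⱽ (λ u → Q u * χ u v)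

    -- Two pebbles leave `s` and one arrives at `t`, so `χ-step` gives the bound. Both changes are
    -- added rather than subtracted to stay in ℕ.
    Φ-move : ∀ {Q Q′} v (mv : Move G Q Q′) → Rich (Move.u mv) → Φ v Q′ ≤ Φ v Q
    Φ-move {Q} {Q′} v mv r = +-cancelʳ-≤ (2 * χ s v) (Φ v Q′) (Φ v Q) (begin
      Φ v Q′ + 2 * χ s v
        ≡⟨ cong (Φ v Q′ +_) (∑ⱽ-single s (λ w → 2 * χ w v)) ⟨
      Φ v Q′ + ∑ⱽ (λ w → ⟦ w ≟ⱽ s ⟧ * (2 * χ w v))
        ≡⟨ ∑ⱽ-+ (λ w → Q′ w * χ w v) (λ w → ⟦ w ≟ⱽ s ⟧ * (2 * χ w v)) ⟨
      ∑ⱽ (λ w → Q′ w * χ w v + ⟦ w ≟ⱽ s ⟧ * (2 * χ w v))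
        ≡⟨ ∑ⱽ-cong balance ⟩
      ∑ⱽ (λ w → Q w * χ w v + ⟦ w ≟ⱽ t ⟧ * χ w v)
        ≡⟨ ∑ⱽ-+ (λ w → Q w * χ w v) (λ w → ⟦ w ≟ⱽ t ⟧ * χ w v) ⟩
      Φ v Q + ∑ⱽ (λ w → ⟦ w ≟ⱽ t ⟧ * χ w v)
        ≡⟨ cong (Φ v Q +_) (∑ⱽ-single t (λ w → χ w v)) ⟩
      Φ v Q + χ t v
        ≤⟨ +-monoʳ-≤ (Φ v Q) (χ-step v r adj) ⟩
      Φ v Q + 2 * χ s v ∎)
      where
      open ≤-Reasoning
      open Move mv renaming (u to s; v to t)
      balance : ∀ w → Q′ w * χ w v + ⟦ w ≟ⱽ s ⟧ * (2 * χ w v) ≡ Q w * χ w v + ⟦ w ≟ⱽ t ⟧ * χ w v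
      balance w with w ≟ⱽ s | w ≟ⱽ t
      -- A move from a vertex to itself would make its count both fall by two and rise by one.
      ... | yes refl | yes refl = contradiction (trans (cong (_+ 2) (sym at-v)) at-u) (m≢1+n+m _ ∘ sym ∘ trans (+-comm 2 (suc (Q s))))
      ... | yes refl | no _ = trans (arith (Q′ s) (χ s v)) (cong (λ q → q * χ s v + 0) at-u)
        where
        arith : ∀ q c → q * c + 1 * (2 * c) ≡ (q + 2) * c + 0
        arith = solve-∀
      ... | no _ | yes refl = trans (cong (λ q → q * χ t v + 0) at-v) (arith (Q t) (χ t v))
        where
        arith : ∀ q c → suc q * c + 0 ≡ q * c + 1 * c
        arith = solve-∀
      ... | no w≢s | no w≢t = cong (λ q → q * χ w v + 0) (others w w≢s w≢t)

    Φ-moves : ∀ {Q₀ Q} v → Moves G P Q₀ → Moves G Q₀ Q → Φ v Q ≤ Φ v Q₀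
    Φ-moves v _ ε = ≤-refl
    Φ-moves v P⟶Q₀ (mv ◅ mvs) =
      ≤-trans (Φ-moves v (P⟶Q₀ ◅◅ mv ◅ ε) mvs) (Φ-move v mv (mover-rich P⟶Q₀ mv))

    -- The trivial walk at `v` is a geodesic, so each pebble on `v` is worth `2 * E`, the scaled
    -- unit of `ψ`. Two pebbles gathered there are worth `4 * E`, and no move increased `Φ`.
    Φ-rich : ∀ {v} → Rich v → 4 * E ≤ Φ v P
    Φ-rich {v} r@(Q , P⟶Q , 2≤Q) = begin
      4 * E              ≡⟨ *-assoc 2 2 E ⟩
      2 * (2 * E)        ≡⟨ cong (2 *_) χvv ⟨
      2 * χ v v          ≤⟨ *-monoˡ-≤ (χ v v) 2≤Q ⟩
      Q v * χ v v        ≤⟨ term≤∑ⱽ v (λ u → Q u * χ u v) ⟩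
      Φ v Q              ≤⟨ Φ-moves v ε P⟶Q ⟩
      Φ v P              ∎
      where
      open ≤-Reasoning
      χvv : χ v v ≡ 2 * E
      χvv = trans (cong (_* ψ v v) (⟦⟧-yes (rich? v) r)) (trans (*-identityˡ _)
        (trans (ψ-geodesic (subst (λ s → Walk s v v) (sym (dist-refl v)) (halt r))) (cong (2 *_) (K-refl v))))

    -- What one pebble on `u` gives towards the `4 * E` demanded by `x`: its potential at v(x), or,
    -- for a poor pebbled `x`, the whole amount exactly when `u` is `x`.
    contribution : V G → ∀ {x} → Status x → ℕ
    contribution u {x} (rich _)       = χ u x
    contribution u     (near _ v _ _) = χ u v
    contribution u {x} (pebbled _ _)  = ⟦ x ≟ⱽ u ⟧ * (4 * E)

    4E≤contributions : ∀ {x} (σ : Status x) → 4 * E ≤ ∑ⱽ (λ u → P u * contribution u σ)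
    4E≤contributions (rich r)       = Φ-rich r
    4E≤contributions (near _ v r _) = Φ-rich r
    4E≤contributions {x} (pebbled _ 1≤P) = begin
      4 * E                                       ≤⟨ m≤n*m (4 * E) (P x) {{>-nonZero 1≤P}} ⟩
      P x * (4 * E)                               ≡⟨ cong (P x *_) (trans (cong (_* (4 * E)) (⟦⟧-yes (x ≟ⱽ x) refl)) (*-identityˡ _)) ⟨
      P x * (⟦ x ≟ⱽ x ⟧ * (4 * E))                ≤⟨ term≤∑ⱽ x (λ u → P u * (⟦ x ≟ⱽ u ⟧ * (4 * E))) ⟩
      ∑ⱽ (λ u → P u * (⟦ x ≟ⱽ u ⟧ * (4 * E)))     ∎
      where open ≤-Reasoning

    module _ (σ : ∀ x → Status x) where

      contributions-poor : ∀ u → ¬ Rich u → ∑ⱽ (λ x → contribution u (σ x)) ≤ 4 * E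
      contributions-poor u ¬r = ≤-trans (∑ⱽ-mono λ x → bound (σ x)) (≤-reflexive (∑ⱽ-single u (λ _ → 4 * E)))
        where
        χ≡0 : ∀ v → χ u v ≡ 0
        χ≡0 v = cong (_* ψ u v) (⟦⟧-no (rich? u) ¬r)
        bound : ∀ {x} (σ : Status x) → contribution u σ ≤ ⟦ x ≟ⱽ u ⟧ * (4 * E)
        bound {x} (rich _)       = ≤-trans (≤-reflexive (χ≡0 x)) z≤n
        bound     (near _ v _ _) = ≤-trans (≤-reflexive (χ≡0 v)) z≤n
        bound     (pebbled _ _)  = ≤-refl

      module _ (u : V G) (r : Rich u) where

        g : V G → ℕ
        g x = ⟦ geodesic? u x ⟧

        -- Marks the x whose contribution exceeds 2 K u x (it is then 4 K u x).
        overweight : ∀ {x} → Status x → ℕ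
        overweight {x} (near _ v _ _) = ⟦ geodesic? u v ⟧ * ⟦ dist u x ≟ℕ suc (dist u v) ⟧
        overweight     _              = 0

        -- A geodesic has a rich target, so a poor `x` has `g x` = 0, and only a poor `x` can be
        -- overweight.
        g+overweight≤1 : ∀ {x} (σ : Status x) → g x + overweight σ ≤ 1
        g+overweight≤1 {x} (rich _)      = ≤-trans (≤-reflexive (+-identityʳ _)) (⟦⟧≤1 (geodesic? u x))
        g+overweight≤1 {x} (pebbled _ _) = ≤-trans (≤-reflexive (+-identityʳ _)) (⟦⟧≤1 (geodesic? u x))
        g+overweight≤1 {x} (near ¬r v _ _)
          rewrite ⟦⟧-no (geodesic? u x) (¬r ∘ target-rich) =
          *-mono-≤ (⟦⟧≤1 (geodesic? u v)) (⟦⟧≤1 (dist u x ≟ℕ suc (dist u v)))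

        -- For the end of a geodesic the predecessor is the last but one vertex; for an overweight
        -- vertex it is the rich neighbour stored in its status.
        g-pred : ∀ {y} (σ : Status y) → 1 ≤ g y + overweight σ →
          y ≡ u ⊎ ∃ λ p → Adj G p y × 1 ≤ g p × dist u y ≡ suc (dist u p)
        g-pred {y} σ 1≤ with geodesic? u y
        g-pred {y} σ _ | yes γ with geodesic-pred γ
        ... | inj₁ y≡u = inj₁ y≡u
        ... | inj₂ (p , p~y , γ′ , e) = inj₂ (p , p~y , ≤-reflexive (sym (⟦⟧-yes (geodesic? u p) γ′)) , e)
        g-pred {y} (near _ v _ v~y) 1≤ | no _ with geodesic? u v in eq | dist u y ≟ℕ suc (dist u v)
        ... | yes γ | yes e = inj₂ (v , v~y , ≤-reflexive (sym (cong ⟦_⟧ eq)) , e)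
        g-pred (near _ v _ v~y) () | no _ | yes _ | no _
        g-pred (near _ v _ v~y) () | no _ | no _ | _
        g-pred (rich _) () | no _
        g-pred (pebbled _ _) () | no _

        -- For `near`, compare `x` with its neighbour `v`. If `x` is no farther from `u`, then
        -- `2 * K u v` is at most `2 * K u x`. If it is farther, `K u v` is at most `2 * K u x`, and
        -- a geodesic to `v` doubles this to the overweight bound.
        contribution≤ : ∀ {x} (σ : Status x) → contribution u σ ≤ 2 * K u x + 2 * (overweight σ * K u x)
        contribution≤ {x} (rich _) = ≤-trans (χ≤ψ u x) (≤-trans (ψ≤2K u x) (m≤m+n _ _))
        -- Here `u` is rich and `x` poor, so they differ and the indicator vanishes.
        contribution≤ {x} (pebbled ¬r _) = ≤-trans (≤-reflexive (cong (_* (4 * E)) (⟦⟧-no (x ≟ⱽ u) (λ { refl → ¬r r })))) z≤n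
        contribution≤ {x} (near _ v _ v~x) = ≤-trans (χ≤ψ u v) ψ≤
          where
          ψ≤ : ψ u v ≤ 2 * K u x + 2 * ((⟦ geodesic? u v ⟧ * ⟦ dist u x ≟ℕ suc (dist u v) ⟧) * K u x)
          ψ≤ with dist u x ≟ℕ suc (dist u v)
          ... | no ne = begin
            ψ u v      ≤⟨ ψ≤2K u v ⟩
            2 * K u v  ≤⟨ *-monoʳ-≤ 2 (weight-antitone M dist≥) ⟩
            2 * K u x  ≤⟨ m≤m+n _ _ ⟩
            _          ∎
            where
            open ≤-Reasoning
            dist≥ : dist u x ≤ dist u v
            dist≥ = s≤s⁻¹ (≤∧≢⇒< (dist-lipschitz u v~x) ne)
          ... | yes e = begin
            (1 + b) * K u v                        ≤⟨ *-monoʳ-≤ (1 + b) (weight-lipschitz M (≤-reflexive e)) ⟩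
            (1 + b) * (2 * K u x)                  ≡⟨ arith b (K u x) ⟩
            2 * K u x + 2 * ((b * 1) * K u x)      ∎
            where
            open ≤-Reasoning
            b : ℕ
            b = ⟦ geodesic? u v ⟧
            arith : ∀ b c → (1 + b) * (2 * c) ≡ 2 * c + 2 * ((b * 1) * c)
            arith = solve-∀

        -- Plain weights give 9 and overweight vertices 4, both in the unit `2 * E`.
        contributions-rich : ∑ⱽ (λ x → contribution u (σ x)) ≤ 26 * E
        contributions-rich = begin
          ∑ⱽ (λ x → contribution u (σ x))
            ≤⟨ ∑ⱽ-mono (λ x → contribution≤ (σ x)) ⟩
          ∑ⱽ (λ x → 2 * K u x + 2 * (τ x * K u x))
            ≡⟨ trans (∑ⱽ-+ (λ x → 2 * K u x) (λ x → 2 * (τ x * K u x)))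
                     (cong₂ _+_ (∑ⱽ-*ˡ 2 (K u)) (∑ⱽ-*ˡ 2 (λ x → τ x * K u x))) ⟩
          2 * ∑ⱽ (K u) + 2 * ∑ⱽ (λ x → τ x * K u x)
            ≤⟨ +-mono-≤ (*-monoʳ-≤ 2 (∑K≤ u)) (*-monoʳ-≤ 2 (Boundary.∑τK≤ u g τ (g+overweight≤1 ∘ σ) (λ y → g-pred (σ y)))) ⟩
          2 * (9 * E) + 2 * (4 * E)
            ≡⟨ arith E ⟩
          26 * E ∎
          where
          open ≤-Reasoning
          τ : V G → ℕ
          τ x = overweight (σ x)
          arith : ∀ e → 2 * (9 * e) + 2 * (4 * e) ≡ 26 * e
          arith = solve-∀

      contributions≤ : ∀ u → ∑ⱽ (λ x → contribution u (σ x)) ≤ 26 * E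
      contributions≤ u with rich? u
      ... | yes r = contributions-rich u r
      ... | no ¬r = ≤-trans (contributions-poor u ¬r) (*-monoˡ-≤ E (m≤m+n 4 22))

    -- Every vertex demands `4 * E` and every pebble supplies at most `26 * E` in total, so
    -- exchanging the two sums compares demand with supply.
    size-bound : Solvable G P → 2 * (suc l * suc k) ≤ 13 * size (suc k) (suc l) P
    size-bound solvable = *-cancelˡ-≤ (2 * E) {{m*n≢0 2 E {{_}} {{m^n≢0 2 M}}}} (begin
      2 * E * (2 * (suc l * suc k))
        ≡⟨ arith₁ E (suc l) (suc k) ⟩
      suc k * suc l * (4 * E)
        ≡⟨ ∑ⱽ-const {suc k} {suc l} (4 * E) ⟨
      ∑ⱽ {suc k} {suc l} (λ x → 4 * E)
        ≤⟨ ∑ⱽ-mono (λ x → 4E≤contributions (σ x)) ⟩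
      ∑ⱽ (λ x → ∑ⱽ (λ u → P u * contribution u (σ x)))
        ≡⟨ ∑ⱽ-comm (λ x u → P u * contribution u (σ x)) ⟩
      ∑ⱽ (λ u → ∑ⱽ (λ x → P u * contribution u (σ x)))
        ≤⟨ ∑ⱽ-mono (λ u → ≤-trans (≤-reflexive (∑ⱽ-*ˡ (P u) (λ x → contribution u (σ x)))) (*-monoʳ-≤ (P u) (contributions≤ σ u))) ⟩
      ∑ⱽ (λ u → P u * (26 * E))
        ≡⟨ trans (∑ⱽ-cong (λ u → *-comm (P u) (26 * E))) (∑ⱽ-*ˡ (26 * E) P) ⟩
      26 * E * ∑ⱽ P
        ≡⟨ cong (26 * E *_) (size≡∑ⱽ P) ⟨
      26 * E * size (suc k) (suc l) P
        ≡⟨ arith₂ E (size (suc k) (suc l) P) ⟩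
      2 * E * (13 * size (suc k) (suc l) P) ∎)
      where
      open ≤-Reasoning
      σ : ∀ x → Status x
      σ x = status x (solvable x)
      arith₁ : ∀ e b a → 2 * e * (2 * (b * a)) ≡ a * b * (4 * e)
      arith₁ = solve-∀
      arith₂ : ∀ e s → 26 * e * s ≡ 2 * e * (13 * s)
      arith₂ = solve-∀

-- Discharging the decidability assumptions

¬¬-dec : ∀ {m n} (A : Fin m × Fin n → Set) → ¬ ¬ (∀ x → Dec (A x))
-- The vertices form a finite set, so double negation passes through the quantifier, one coordinate
-- at a time.
¬¬-dec A = RawMonad._<$>_ ¬¬-Monad uncurry
  (sequence applicative λ a → sequence applicative λ b → ¬¬-excluded-middle)
  where open RawMonad ¬¬-Monad using () renaming (rawApplicative to applicative)

theorem5p6 : (m n : ℕ) → 5 ≤ m → 5 ≤ n →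
    (P : Distribution (Torus m n)) → Solvable (Torus m n) P →
    2 * (n * m) ≤ 13 * size m n P
-- A decidable inequality is stable under double negation, so deciders for `Rich` and `Geodesic` may
-- be assumed while proving it.
theorem5p6 (suc k) (suc l) _ _ P solvable = decidable-stable (_ ≤? _) λ ¬bound →
  ¬¬-dec Rich λ rich? →
  sequence₂ λ geodesic? →
  ¬bound (Classical.size-bound rich? geodesic? solvable)
  where
  open Pebbling k l P
  open RawMonad ¬¬-Monad using () renaming (rawApplicative to applicative)
  sequence₂ : ¬ ¬ (∀ u v → Dec (Geodesic u v))
  sequence₂ = RawMonad._<$>_ ¬¬-Monad uncurry
    (sequence applicative λ a → sequence applicative λ b → ¬¬-dec (Geodesic (a , b)))
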